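{- Let $F$ be a graph of constant link $L$ and order $k \geq 3$. Let $(H_t)_{t\geq 1}$ be a sequence such that each $H_t$ is a $k$-uniform, $n_t$-regular hypergraph of order $v_t$, and suppose that $n_1 = k$ and $n_t = k\prod_{i=1}^{t-1} v_i$ holds for every $t \geq 2$. Let $G_1 = F$, and define $G_{i+1} = \Gamma(G_i, H_i)$ for $i \geq 1$. Then the following holds for every $t \geq 1$. (i) The graph $G_t$ has constant link $tL$ and order $n_t$. (ii) If $F$ has circumference $c$, and $H_i$ has girth $g > c/2$ for $1 \leq i \leq t-1$, then $G_t$ has no cycles of length $\ell$ for any $c < \ell < 2g$. (iii) If $G_t$ and $H_t$ are connected, then $G_{t+1}$ is connected, too.
   Context: All graphs are finite and simple; order means number of vertices. A graph $G$ has constant link $L$ if for every vertex $v$ the subgraph induced by the open neighborhood $N(v)$ is isomorphic to $L$; $tL$ is the disjoint union of $t$ copies of $L$. The circumference of a graph is the length of a longest cycle. A hypergraph is $k$-uniform if all its edges have size $k$, and $n$-regular if every vertex lies in exactly $n$ edges. A (Berge) cycle of length $m$ in a hypergraph is a sequence $(v_0,e_0,v_1,e_1,\dots,v_{m-1},e_{m-1})$ of distinct vertices $v_i$ and distinct edges $e_i$ with $v_i\in e_{i-1}\cap e_i$ (indices mod $m$), $m\ge2$. The girth is the length of a shortest cycle. Construction of $\Gamma(G,H)$ (relative to $F$): let $F$ be a graph with constant link $L$ and order $k\ge3$, $G$ a graph of order $n$ and constant link $tL$ for some $t\ge1$, and $H$ an $n$-regular $k$-uniform hypergraph of order $N$ with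 vertices $x_1,\dots,x_N$. (1) At each vertex $x$ of $H$ enumerate the hyperedges containing $x$ as $E_{x,1},\dots,E_{x,n}$. (2) Take $N$ disjoint copies of $G$ on vertex sets $V_1,\dots,V_N$, $V_i=\{v_{i,1},\dots,v_{i,n}\}$, and set $V(\Gamma)=V_1\cup\dots\cup V_N$. (3) With each edge $E$ of $H$ associate the $k$-element set $f(E)\subseteq V(\Gamma)$ defined by $v_{i,j}\in f(E)$ if and only if $E_{x_i,j}=E$. (4) For each hyperedge $E$ of $H$, place a copy of $F$ on the set $f(E)$. The resulting graph (for any choice of the enumerations and placements) is $\Gamma(G,H)$.
   Formalization: In (iii) the graph F is additionally assumed connected; without this (iii) can fail for t ≥ 2 (e.g. F = 2K_2 with suitable placements), while for t = 1 it is automatic since G_1 = F. -}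

module Defs where

open import Data.Fin using (Fin; toℕ)
open import Data.Fin.Properties using (any?) renaming (_≟_ to _≟ᶠ_)
open import Data.Fin.Subset using (Subset; _∈_; _∩_; ∣_∣)
open import Data.Fin.Subset.Properties using (_∈?_)
open import Data.Irrelevant using ([_])
open import Data.List using (length; filter; allFin)
open import Data.Nat using (ℕ; suc; _≤_)
open import Data.Nat.DivMod using (_mod_)
open import Data.Product using (Σ-syntax; ∃-syntax; _×_; _,_)
open import Data.Refinement using (Refinement-syntax; value; _,_)
open import Data.Sum using (_⊎_; inj₁; inj₂)
open import Function.Bundles using (_↔_; _⇔_; Inverse)
open import Function.Definitions using (Injective)
open import Relation.Binary.Construct.Closure.ReflexiveTransitive using (Star)
open import Relation.Binary.PropositionalEquality using (_≡_; refl; sym)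
open import Relation.Nullary using (¬_; Dec; yes; no)
open import Relation.Nullary.Decidable using (_×-dec_; _⊎-dec_)

-- Finiteness is not built in: it is expressed by HasOrder.
record Graph : Set₁ where
  field
    Vertex     : Set
    Adj        : Vertex → Vertex → Set
    adj?       : ∀ u w → Dec (Adj u w)
    adj-sym    : ∀ {u w} → Adj u w → Adj w u
    adj-irrefl : ∀ {u} → ¬ Adj u u

open Graph public

HasOrder : Graph → ℕ → Set
HasOrder G n = Fin n ↔ Vertex G

record _≅_ (G K : Graph) : Set where
  field
    vertices : Vertex G ↔ Vertex K
    adjacent : ∀ u w → Adj G u w ⇔ Adj K (Inverse.to vertices u) (Inverse.to vertices w)

infix 4 _≅_

-- The refinement type makes membership proofs irrelevant, so that the vertices
-- of the induced subgraph are vertices of G and not vertices paired with proofs.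
induced : (G : Graph) → (Vertex G → Set) → Graph
induced G P = record
  { Vertex     = [ u ∈ Vertex G ∣ P u ]
  ; Adj        = λ u w → Adj G (value u) (value w)
  ; adj?       = λ u w → adj? G (value u) (value w)
  ; adj-sym    = adj-sym G
  ; adj-irrefl = adj-irrefl G
  }

ConstantLink : Graph → Graph → Set
ConstantLink G L = ∀ v → induced G (Adj G v) ≅ L

_·_ : ℕ → Graph → Graph
t · L = record
  { Vertex     = Fin t × Vertex L
  ; Adj        = λ (i , u) (j , w) → i ≡ j × Adj L u w
  ; adj?       = λ (i , u) (j , w) → (i ≟ᶠ j) ×-dec adj? L u w
  ; adj-sym    = λ (i≡j , a) → sym i≡j , adj-sym L a
  ; adj-irrefl = λ (_ , a) → adj-irrefl L a
  }

infixr 7 _·_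

next : ∀ {m} → Fin m → Fin m
next {suc m} i = suc (toℕ i) mod suc m

record Cycle (G : Graph) (ℓ : ℕ) : Set where
  field
    3≤ℓ      : 3 ≤ ℓ
    vertex   : Fin ℓ → Vertex G
    distinct : Injective _≡_ _≡_ vertex
    adjacent : ∀ i → Adj G (vertex i) (vertex (next i))

Circumference : Graph → ℕ → Set
Circumference G c = Cycle G c × (∀ ℓ → Cycle G ℓ → ℓ ≤ c)

Connected : Graph → Set
Connected G = Vertex G × (∀ u w → Star (Adj G) u w)

-- A hypergraph on the vertices x_1, …, x_N, with a set of edges (no repeated edges).
record Hypergraph (N : ℕ) : Set where
  field
    size          : ℕ
    edge          : Fin size → Subset N
    edge-distinct : Injective _≡_ _≡_ edge

open Hypergraph public

Uniform : ∀ {N} → Hypergraph N → ℕ → Set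
Uniform H k = ∀ e → ∣ edge H e ∣ ≡ k

degree : ∀ {N} → Hypergraph N → Fin N → ℕ
degree H x = length (filter (λ e → x ∈? edge H e) (allFin (size H)))

Regular : ∀ {N} → Hypergraph N → ℕ → Set
Regular H n = ∀ x → degree H x ≡ n

record BergeCycle {N : ℕ} (H : Hypergraph N) (m : ℕ) : Set where
  field
    2≤m             : 2 ≤ m
    vertex          : Fin m → Fin N
    edgeAt          : Fin m → Fin (size H)
    vertex-distinct : Injective _≡_ _≡_ vertex
    edgeAt-distinct : Injective _≡_ _≡_ edgeAt
    incident        : ∀ i → vertex (next i) ∈ edge H (edgeAt i) ∩ edge H (edgeAt (next i))

Girth : ∀ {N} → Hypergraph N → ℕ → Set
Girth H g = BergeCycle H g × (∀ m → BergeCycle H m → g ≤ m)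

HConnected : ∀ {N} → Hypergraph N → Set
HConnected {N} H =
  Fin N × (∀ x y → Star (λ u w → ∃[ e ] (u ∈ edge H e × w ∈ edge H e)) x y)

-- The choices made in the construction of Γ(G,H).  The vertex v_{i,j} is the
-- pair (i , j), and E i j is the edge E_{x_i,j}.
record Choices {N : ℕ} (F G : Graph) (H : Hypergraph N) (n : ℕ) : Set where
  field
    E          : Fin N → Fin n → Fin (size H)
    E-distinct : ∀ i → Injective _≡_ _≡_ (E i)
    E-through  : ∀ i e → i ∈ edge H e ⇔ (∃[ j ] E i j ≡ e)
    copy       : Fin N → Fin n ↔ Vertex G

  _∈f_ : Fin N × Fin n → Fin (size H) → Set
  (i , j) ∈f e = E i j ≡ e

  field
    place : ∀ e → Vertex F ↔ [ u ∈ Fin N × Fin n ∣ u ∈f e ]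

module _ {N n : ℕ} {F G : Graph} {H : Hypergraph N} (C : Choices F G H n) where
  open Choices C

  private
    V : Set
    V = Fin N × Fin n

  AdjInCopy : V → V → Set
  AdjInCopy (i , a) (j , b) = i ≡ j × Adj G (Inverse.to (copy i) a) (Inverse.to (copy i) b)

  AdjOnEdge : Fin (size H) → V → V → Set
  AdjOnEdge e u w =
    Σ[ p ∈ u ∈f e ] Σ[ q ∈ w ∈f e ]
      Adj F (Inverse.from (place e) (u , [ p ])) (Inverse.from (place e) (w , [ q ]))

  private
    inCopy? : ∀ u w → Dec (AdjInCopy u w)
    inCopy? (i , a) (j , b) =
      (i ≟ᶠ j) ×-dec adj? G (Inverse.to (copy i) a) (Inverse.to (copy i) b)

    onEdge? : ∀ u w e → Dec (AdjOnEdge e u w)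
    onEdge? u@(i , a) w@(j , b) e with E i a ≟ᶠ e | E j b ≟ᶠ e
    ... | no ¬p | _     = no λ (p , _) → ¬p p
    ... | yes _ | no ¬q = no λ (_ , q , _) → ¬q q
    ... | yes p | yes q
      with adj? F (Inverse.from (place e) (u , [ p ])) (Inverse.from (place e) (w , [ q ]))
    ...   | yes r = yes (p , q , r)
    ...   | no ¬r = no λ (_ , _ , r) → ¬r r

    Γ-sym : ∀ {u w} → AdjInCopy u w ⊎ (∃[ e ] AdjOnEdge e u w) →
            AdjInCopy w u ⊎ (∃[ e ] AdjOnEdge e w u)
    Γ-sym (inj₁ (refl , a))      = inj₁ (refl , adj-sym G a)
    Γ-sym (inj₂ (e , p , q , a)) = inj₂ (e , q , p , adj-sym F a)

    Γ-irrefl : ∀ {u} → ¬ (AdjInCopy u u ⊎ (∃[ e ] AdjOnEdge e u u))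
    Γ-irrefl (inj₁ (_ , a))         = adj-irrefl G a
    Γ-irrefl (inj₂ (_ , _ , _ , a)) = adj-irrefl F a

  Γ : Graph
  Γ = record
    { Vertex     = V
    ; Adj        = λ u w → AdjInCopy u w ⊎ (∃[ e ] AdjOnEdge e u w)
    ; adj?       = λ u w → inCopy? u w ⊎-dec any? (onEdge? u w)
    ; adj-sym    = λ {u} {w} → Γ-sym {u} {w}
    ; adj-irrefl = λ {u} → Γ-irrefl {u}
    }

-- The assumptions under which Γ(G,H), relative to F, is defined.  As Γ is partial,
-- a recursion G_{i+1} = Γ(G_i,H_i) is stated with Admissible as a premise at each
-- i, so that it does not presuppose the order and the link of G_i.
record Admissible {N : ℕ} (F L G : Graph) (H : Hypergraph N) (k n : ℕ) : Set where
  field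
    3≤k       : 3 ≤ k
    F-link    : ConstantLink F L
    F-order   : HasOrder F k
    G-link    : ∃[ s ] (1 ≤ s × ConstantLink G (s · L))
    G-order   : HasOrder G n
    H-uniform : Uniform H k
    H-regular : Regular H n

-- K is Γ(G,H) for some choice of the enumerations and placements.
IsΓ : ∀ {N} (F G : Graph) (H : Hypergraph N) (n : ℕ) → Graph → Set
IsΓ F G H n K = Σ[ C ∈ Choices F G H n ] K ≅ Γ C

{-# OPTIONS --safe #-}

-- For (ii), read each vertex v_{i,j} of Γ(G,H) as a flag (x_i , E_{x_i,j}) of H, that is,
-- as an edge of the incidence graph of H.  Adjacent vertices of Γ(G,H) are flags with a
-- common point (both in a copy of G) or a common block (both in a copy of F), so a cycle
-- of length ℓ is a cyclic sequence of ℓ distinct flags, consecutive ones sharing an end.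
-- If all these shared ends agree, then the cycle lies in a single copy of G or of F.
-- Otherwise, dropping repeated ends leaves a nonempty closed trail in the incidence
-- graph, hence a cycle there of length 2m ≤ ℓ, which is a Berge cycle of length m in H.
module Submission where

open import Defs
open import Data.Fin using (Fin; zero; suc; fromℕ; inject₁)
open import Data.Fin.Properties
  using (toℕ-injective; toℕ-fromℕ<; toℕ-fromℕ; toℕ-inject₁; toℕ<n; suc-injective; 0≢1+n; *↔×)
  renaming (_≟_ to _≟ᶠ_)
open import Data.Fin.Relation.Unary.Top using (view; ‵fromℕ; ‵inject₁)
open import Data.Fin.Subset using (_∈_)
open import Data.Fin.Subset.Properties using (x∈p∩q⁺)
open import Data.Irrelevant using ([_])
open import Data.List using (List; []; _∷_; _++_; length; map; tabulate; applyUpTo; product)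
import Data.List.Membership.DecPropositional as DecMembership
open import Data.List.Membership.Propositional using () renaming (_∈_ to _∈ˡ_)
open import Data.List.Properties using (length-map; length-tabulate; applyUpTo-∷ʳ)
open import Data.List.Relation.Binary.Sublist.Propositional
  using (_⊆_; []; _∷ʳ_; _∷_; minimum; ⊆-refl; ⊆-trans)
open import Data.List.Relation.Binary.Sublist.Propositional.Properties
  using (All-resp-⊆; length-mono-≤)
open import Data.List.Relation.Unary.All using (All; []; _∷_) renaming (lookup to All-lookup)
open import Data.List.Relation.Unary.All.Properties using (¬Any⇒All¬)
open import Data.List.Relation.Unary.AllPairs using ([]; _∷_)
open import Data.List.Relation.Unary.Any using (here; there)
open import Data.List.Relation.Unary.Unique.Propositional using (Unique)
open import Data.List.Relation.Unary.Unique.Propositional.Properties using (map⁺; tabulate⁺)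
open import Data.Nat using (ℕ; zero; suc; _+_; _*_; _∸_; _≤_; _<_; z≤n; s≤s)
open import Data.Nat.DivMod using (_%_; m<n⇒m%n≡m; n%n≡0)
open import Data.Nat.ListAction.Properties using (product-++)
open import Data.Nat.Properties
  using (≤-trans; ≤-refl; ≤-reflexive; ≤-<-trans; <⇒≱; n≤1+n; m≤n⇒m≤1+n;
         *-suc; *-monoʳ-≤; *-assoc; *-comm; *-identityʳ)
open import Data.Product using (Σ-syntax; ∃-syntax; _×_; _,_; proj₁; proj₂; swap)
open import Data.Product.Properties using (,-injectiveˡ; ,-injectiveʳ)
open import Data.Refinement using (value; _,_)
open import Data.Refinement.Properties using (value-injective)
open import Data.Sum as Sum using (_⊎_; inj₁; inj₂) renaming (swap to ⊎-swap)
open import Data.Sum.Properties using (≡-dec)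
open import Data.Vec.Functional using () renaming (_∷_ to _∷ᶠ_)
open import Function using (_∘_; flip; _⇔_; _↔_; mk⇔; mk⤖; Inverse; Equivalence)
open import Function.Definitions using (Injective)
open import Function.Properties.Bijection using (⤖⇒↔)
open import Function.Properties.Inverse using (↔-sym; ↔-trans)
open import Relation.Binary.Construct.Closure.ReflexiveTransitive using (Star; ε; _◅_; _◅◅_; gmap)
open import Relation.Binary.Definitions using (DecidableEquality)
open import Relation.Binary.PropositionalEquality
  using (_≡_; _≢_; refl; sym; trans; cong; subst; subst₂; module ≡-Reasoning)
open import Relation.Nullary using (¬_; yes; no; contradiction)
open import Relation.Nullary.Decidable using (recompute)
open import Relation.Unary using (Decidable)

open Inverse using (to; from; strictlyInverseˡ; strictlyInverseʳ)

-- Cyclic successor and injective sequences.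

next-inject₁ : ∀ {m} (i : Fin m) → next (inject₁ i) ≡ suc i
next-inject₁ {m} i = toℕ-injective (trans (toℕ-fromℕ< _)
  (trans (m<n⇒m%n≡m (s≤s (subst (_< m) (sym (toℕ-inject₁ i)) (toℕ<n i))))
    (cong suc (toℕ-inject₁ i))))

next-fromℕ : ∀ m → next (fromℕ m) ≡ zero
next-fromℕ m = toℕ-injective (trans (toℕ-fromℕ< _)
  (trans (cong (λ a → suc a % suc m) (toℕ-fromℕ m)) (n%n≡0 (suc m))))

next-injective : ∀ {m} → Injective _≡_ _≡_ (next {m})
next-injective {suc m} {i} {j} eq with view i | view j
... | ‵fromℕ     | ‵fromℕ     = refl
... | ‵fromℕ     | ‵inject₁ j =
  contradiction (trans (sym (next-fromℕ m)) (trans eq (next-inject₁ j))) 0≢1+n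
... | ‵inject₁ i | ‵fromℕ     =
  contradiction (trans (sym (next-fromℕ m)) (trans (sym eq) (next-inject₁ i))) 0≢1+n
... | ‵inject₁ i | ‵inject₁ j =
  cong inject₁ (suc-injective (trans (sym (next-inject₁ i)) (trans eq (next-inject₁ j))))

-- The map `f` is there for the inclusions `inj₁` and `inj₂`: the new entry lies on one side of a
-- bipartite graph, while the list it avoids is the support of a walk and mixes both sides.
∷-injective : ∀ {A B : Set} (f : A → B) {m} {a} {g : Fin m → A} {l} →
  (∀ s → f (g s) ∈ˡ l) → All (f a ≢_) l → Injective _≡_ _≡_ g → Injective _≡_ _≡_ (a ∷ᶠ g)
∷-injective f g∈ a∉ inj {zero}  {zero}  _  = refl
∷-injective f g∈ a∉ inj {zero}  {suc j} eq = contradiction (cong f eq) (All-lookup a∉ (g∈ j))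
∷-injective f g∈ a∉ inj {suc i} {zero}  eq = contradiction (cong f (sym eq)) (All-lookup a∉ (g∈ i))
∷-injective f g∈ a∉ inj {suc i} {suc j} eq = cong suc (inj eq)

Unique-resp-⊆ : {A : Set} {xs ys : List A} → xs ⊆ ys → Unique ys → Unique xs
Unique-resp-⊆ []         []       = []
Unique-resp-⊆ (_ ∷ʳ s)   (_ ∷ u)  = Unique-resp-⊆ s u
Unique-resp-⊆ (refl ∷ s) (p ∷ u)  = All-resp-⊆ s p ∷ Unique-resp-⊆ s u

-- Walks and cycles in the incidence graph of a relation.

-- A cycle of length `2 * m` in the bipartite graph of `R`, visited in the order `left 0`,
-- `right 0`, `left 1`, `right 1` and so on. For membership of points in blocks this is a Berge
-- cycle of length `m`.
record IncidenceCycle {X Y : Set} (R : X → Y → Set) (m : ℕ) : Set where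
  field
    2≤m             : 2 ≤ m
    left            : Fin m → X
    right           : Fin m → Y
    left-injective  : Injective _≡_ _≡_ left
    right-injective : Injective _≡_ _≡_ right
    incident        : ∀ s → R (left s) (right s)
    incident-next   : ∀ s → R (left (next s)) (right s)

-- The same cycle, started one step later at `right 0`. The vertex after `right s` is
-- `left (next s)`, hence the shift.
dual : ∀ {X Y : Set} {R : X → Y → Set} {m} → IncidenceCycle R m → IncidenceCycle (flip R) m
dual c = record
  { 2≤m             = 2≤m
  ; left            = right
  ; right           = left ∘ next
  ; left-injective  = right-injective
  ; right-injective = next-injective ∘ left-injective
  ; incident        = incident-next
  ; incident-next   = incident ∘ next
  } where open IncidenceCycle c

CycleWithin : {X Y : Set} → (X → Y → Set) → ℕ → Set
CycleWithin R ℓ = ∃[ m ] (2 * m ≤ ℓ × IncidenceCycle R m)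

weaken : ∀ {X Y : Set} {R : X → Y → Set} {ℓ ℓ′} → ℓ ≤ ℓ′ → CycleWithin R ℓ → CycleWithin R ℓ′
weaken ℓ≤ (m , 2m≤ , c) = m , ≤-trans 2m≤ ℓ≤ , c

module _ {X Y : Set} where

  data Walk (R : X → Y → Set) : X ⊎ Y → X ⊎ Y → Set where
    []   : ∀ {p} → Walk R p p
    up   : ∀ {x y p} → R x y → Walk R (inj₂ y) p → Walk R (inj₁ x) p
    down : ∀ {x y p} → R x y → Walk R (inj₁ x) p → Walk R (inj₂ y) p

  data On (a : X × Y) : X ⊎ Y → Set where
    onˡ : On a (inj₁ (proj₁ a))
    onʳ : On a (inj₂ (proj₂ a))

module _ {X Y : Set} {R : X → Y → Set} where

  support : ∀ {p q} → Walk R p q → List (X ⊎ Y)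
  support {p} []         = p ∷ []
  support {p} (up _ w)   = p ∷ support w
  support {p} (down _ w) = p ∷ support w

  flags : ∀ {p q} → Walk R p q → List (X × Y)
  flags []                   = []
  flags (up {x} {y} _ w)     = (x , y) ∷ flags w
  flags (down {x} {y} _ w)   = (x , y) ∷ flags w

  end∈support : ∀ {p q} (w : Walk R p q) → q ∈ˡ support w
  end∈support []         = here refl
  end∈support (up _ w)   = there (end∈support w)
  end∈support (down _ w) = there (end∈support w)

  -- The walk is cut at the given occurrence of `z`. Sublists are recorded because both uniqueness
  -- and length bounds pass to them.
  prefix : ∀ {p q z} (w : Walk R p q) → z ∈ˡ support w →
           Σ[ u ∈ Walk R p z ] (support u ⊆ support w × flags u ⊆ flags w)
  prefix []         (here refl) = [] , ⊆-refl , ⊆-refl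
  prefix (up _ w)   (here refl) = [] , refl ∷ minimum _ , minimum _
  prefix (down _ w) (here refl) = [] , refl ∷ minimum _ , minimum _
  prefix (up r w)   (there z)   = let u , s , f = prefix w z in up r u , refl ∷ s , refl ∷ f
  prefix (down r w) (there z)   = let u , s , f = prefix w z in down r u , refl ∷ s , refl ∷ f

  -- The indexed form of a path from one side to the other. The two support fields carry the
  -- induction, since they show that a vertex put in front is new. The `suc` in `length-flags`
  -- counts the flag that will close the path to a cycle.
  record Alternation {x y} (w : Walk R (inj₁ x) (inj₂ y)) : Set where
    field
      half            : ℕ
      left            : Fin (suc half) → X
      right           : Fin (suc half) → Y
      left-zero       : left zero ≡ x
      right-last      : right (fromℕ half) ≡ y
      left-injective  : Injective _≡_ _≡_ left
      right-injective : Injective _≡_ _≡_ right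
      incident        : ∀ s → R (left s) (right s)
      incident-suc    : ∀ s → R (left (suc s)) (right (inject₁ s))
      left∈support    : ∀ s → inj₁ (left s) ∈ˡ support w
      right∈support   : ∀ s → inj₂ (right s) ∈ˡ support w
      length-flags    : suc (length (flags w)) ≡ 2 * suc half

  alternation : ∀ {x y} (w : Walk R (inj₁ x) (inj₂ y)) → Unique (support w) → Alternation w
  alternation {x} {y} (up r []) _ = record
    { half            = 0
    ; left            = λ _ → x
    ; right           = λ _ → y
    ; left-zero       = refl
    ; right-last      = refl
    ; left-injective  = λ { {zero} {zero} _ → refl }
    ; right-injective = λ { {zero} {zero} _ → refl }
    ; incident        = λ _ → r
    ; incident-suc    = λ ()
    ; left∈support    = λ _ → here refl
    ; right∈support   = λ _ → there (here refl)
    ; length-flags    = refl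
    }
  alternation {x} (up {y = y} r (down r′ w)) ((_ ∷ x∉) ∷ y∉ ∷ u) = record
    { half            = suc half
    ; left            = x ∷ᶠ left
    ; right           = y ∷ᶠ right
    ; left-zero       = refl
    ; right-last      = right-last
    ; left-injective  = ∷-injective inj₁ left∈support x∉ left-injective
    ; right-injective = ∷-injective inj₂ right∈support y∉ right-injective
    ; incident        = λ { zero → r ; (suc s) → incident s }
    ; incident-suc    = λ { zero → subst (λ a → R a y) (sym left-zero) r′ ; (suc s) → incident-suc s }
    ; left∈support    = λ { zero → here refl ; (suc s) → there (there (left∈support s)) }
    ; right∈support   = λ { zero → there (here refl) ; (suc s) → there (there (right∈support s)) }
    ; length-flags    = trans (cong (2 +_) length-flags) (sym (*-suc 2 (suc half)))
    } where open Alternation (alternation w u)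

  closeʳ : ∀ {x y} (r : R x y) (w : Walk R (inj₁ x) (inj₂ y)) →
           Unique (support w) → Unique (flags (down r w)) → CycleWithin R (length (flags (down r w)))
  -- A walk of length 1 cannot be closed up: its only flag would be traversed twice.
  closeʳ _ (up _ []) _ ((a≢a ∷ _) ∷ _) = contradiction refl a≢a
  closeʳ r w@(up _ (down _ _)) u _ = suc half , ≤-reflexive (sym length-flags) , record
    { 2≤m             = 2≤m half length-flags
    ; left            = left
    ; right           = right
    ; left-injective  = left-injective
    ; right-injective = right-injective
    ; incident        = incident
    ; incident-next   = incident-next
    }
    where
    open Alternation (alternation w u)

    2≤m : ∀ h → suc (length (flags w)) ≡ 2 * suc h → 2 ≤ suc h
    -- The case `h = 0` is impossible: `w` has at least two flags, so the left side is at least 3,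
    -- while the right side would be 2.
    2≤m (suc h) _ = s≤s (s≤s z≤n)

    incident-next : ∀ s → R (left (next s)) (right s)
    incident-next s with view s
    -- Where the index wraps around, the incidence is the closing flag `r`; elsewhere it is a step
    -- of the path.
    ... | ‵fromℕ     =
      subst₂ R (sym (trans (cong left (next-fromℕ half)) left-zero)) (sym right-last) r
    ... | ‵inject₁ i =
      subst (λ j → R (left j) (right (inject₁ i))) (sym (next-inject₁ i)) (incident-suc i)

-- Exchange of the two sides.

module _ {X Y : Set} where

  swapWalk : ∀ {R : X → Y → Set} {p q} → Walk R p q → Walk (flip R) (⊎-swap p) (⊎-swap q)
  swapWalk []         = []
  swapWalk (up r w)   = down r (swapWalk w)
  swapWalk (down r w) = up r (swapWalk w)

  support-swapWalk : ∀ {R : X → Y → Set} {p q} (w : Walk R p q) →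
                     support (swapWalk w) ≡ map ⊎-swap (support w)
  support-swapWalk []         = refl
  support-swapWalk (up _ w)   = cong (_ ∷_) (support-swapWalk w)
  support-swapWalk (down _ w) = cong (_ ∷_) (support-swapWalk w)

  flags-swapWalk : ∀ {R : X → Y → Set} {p q} (w : Walk R p q) →
                   flags (swapWalk w) ≡ map swap (flags w)
  flags-swapWalk []         = refl
  flags-swapWalk (up _ w)   = cong (_ ∷_) (flags-swapWalk w)
  flags-swapWalk (down _ w) = cong (_ ∷_) (flags-swapWalk w)

module _ {X Y : Set} {R : X → Y → Set} where

  -- Mirror image of `closeʳ`: the walk is reflected, closed up over `flip R`, and the cycle is
  -- brought back to `R` by `dual`.
  closeˡ : ∀ {x y} (r : R x y) (w : Walk R (inj₂ y) (inj₁ x)) →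
           Unique (support w) → Unique (flags (up r w)) → CycleWithin R (length (flags (up r w)))
  closeˡ r w u f =
    let m , 2m≤ , c = closeʳ r (swapWalk w)
          (subst Unique (sym (support-swapWalk w)) (map⁺ ⊎-swap-injective u))
          (subst Unique (sym (flags-swapWalk (up r w))) (map⁺ (cong swap) f))
    in m , ≤-trans 2m≤ (≤-reflexive same-length) , dual c
    where
    same-length : length (flags (swapWalk (up r w))) ≡ length (flags (up r w))
    same-length = trans (cong length (flags-swapWalk (up r w))) (length-map swap (flags (up r w)))

    ⊎-swap-injective : Injective _≡_ _≡_ (⊎-swap {A = X} {B = Y})
    ⊎-swap-injective {inj₁ _} {inj₁ _} refl = refl
    ⊎-swap-injective {inj₂ _} {inj₂ _} refl = refl

  -- Closed trails contain cycles.

  module _ (_≟_ : DecidableEquality (X ⊎ Y)) where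

    open DecMembership _≟_ using (_∈?_)

    -- Induction on the walk. If its first vertex does not recur, a path stays a path; if it recurs,
    -- the part of the path up to the recurrence is closed up by the first step.
    path-or-cycle : ∀ {p q} (w : Walk R p q) → Unique (flags w) →
                    Unique (support w) ⊎ CycleWithin R (length (flags w))
    path-or-cycle [] _ = inj₁ ([] ∷ [])
    path-or-cycle {p} (up r w) f@(_ ∷ f′) with path-or-cycle w f′ | p ∈? support w
    ... | inj₂ c | _     = inj₂ (weaken (n≤1+n _) c)
    ... | inj₁ u | no p∉ = inj₁ (¬Any⇒All¬ _ p∉ ∷ u)
    ... | inj₁ u | yes p∈ with v , s , t ← prefix w p∈ =
      inj₂ (weaken (s≤s (length-mono-≤ t))
        (closeˡ r v (Unique-resp-⊆ s u) (Unique-resp-⊆ (refl ∷ t) f)))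
    path-or-cycle {p} (down r w) f@(_ ∷ f′) with path-or-cycle w f′ | p ∈? support w
    ... | inj₂ c | _     = inj₂ (weaken (n≤1+n _) c)
    ... | inj₁ u | no p∉ = inj₁ (¬Any⇒All¬ _ p∉ ∷ u)
    ... | inj₁ u | yes p∈ with v , s , t ← prefix w p∈ =
      inj₂ (weaken (s≤s (length-mono-≤ t))
        (closeʳ r v (Unique-resp-⊆ s u) (Unique-resp-⊆ (refl ∷ t) f)))

    -- A nonempty closed walk meets its first vertex again at its end, so it is not a path.
    closed-trail : ∀ {p} (w : Walk R p p) → Unique (flags w) →
                   flags w ≡ [] ⊎ CycleWithin R (length (flags w))
    closed-trail w f with path-or-cycle w f
    closed-trail w          f | inj₂ c        = inj₂ c
    closed-trail []         f | inj₁ _        = inj₁ refl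
    closed-trail (up _ w)   f | inj₁ (p∉ ∷ _) = contradiction refl (All-lookup p∉ (end∈support w))
    closed-trail (down _ w) f | inj₁ (p∉ ∷ _) = contradiction refl (All-lookup p∉ (end∈support w))

  -- From sequences of flags to trails.

  -- A flag is an edge of the incidence graph, and `p`, `q` are ends of it. Different ends give one
  -- step along the flag; equal ends give none. Hence a walk that stays empty has not moved.
  extend : ∀ {a p q z} → R (proj₁ a) (proj₂ a) → On a p → On a q → (w : Walk R q z) →
    Σ[ v ∈ Walk R p z ] (flags v ⊆ a ∷ flags w × (flags v ≡ [] → flags w ≡ [] × q ≡ p))
  extend r onˡ onʳ w = up r w , ⊆-refl , λ ()
  extend r onʳ onˡ w = down r w , ⊆-refl , λ ()
  extend r onˡ onˡ w = w , _ ∷ʳ ⊆-refl , λ eq → eq , refl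
  extend r onʳ onʳ w = w , _ ∷ʳ ⊆-refl , λ eq → eq , refl

  -- The flag `a s` stands between the ends `l s` and `l (s + 1)`. Flags whose two ends agree are
  -- dropped, and if all are dropped then `l` never changes.
  compress : ∀ m (a : Fin m → X × Y) (l : Fin (suc m) → X ⊎ Y) →
    (∀ s → R (proj₁ (a s)) (proj₂ (a s))) →
    (∀ s → On (a s) (l (inject₁ s))) → (∀ s → On (a s) (l (suc s))) →
    Σ[ w ∈ Walk R (l zero) (l (fromℕ m)) ]
      (flags w ⊆ tabulate a × (flags w ≡ [] → ∀ s → l s ≡ l zero))
  compress zero    a l r on on′ = [] , [] , λ { _ zero → refl }
  compress (suc m) a l r on on′ =
    let w , w⊆ , w-const = compress m (a ∘ suc) (l ∘ suc) (r ∘ suc) (on ∘ suc) (on′ ∘ suc)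
        v , v⊆ , v-const = extend (r zero) (on zero) (on′ zero) w
    in v , ⊆-trans v⊆ (refl ∷ w⊆) , λ eq → λ where
         zero    → refl
         (suc s) → let eq′ , q≡p = v-const eq in trans (w-const eq′ s) q≡p

  closed-sequence : DecidableEquality (X ⊎ Y) →
    ∀ {m} (a : Fin (suc m) → X × Y) (l : Fin (suc m) → X ⊎ Y) → Injective _≡_ _≡_ a →
    (∀ s → R (proj₁ (a s)) (proj₂ (a s))) →
    (∀ s → On (a s) (l s)) → (∀ s → On (a (next s)) (l s)) →
    (∃[ p ] (∀ s → l s ≡ p)) ⊎ CycleWithin R (suc m)
  closed-sequence _≟_ {m} a l a-inj r on on-next =
    let w , w⊆ , const = compress (suc m) a l₀ r on₀ on
    in Sum.map
         (λ empty → l (fromℕ m) , const empty ∘ suc)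
         (weaken (≤-trans (length-mono-≤ w⊆) (≤-reflexive (length-tabulate a))))
         (closed-trail _≟_ w (Unique-resp-⊆ w⊆ (tabulate⁺ a-inj)))
    where
    l₀ : Fin (suc (suc m)) → X ⊎ Y
    -- The end before the first flag is the one that it shares with the last flag. Putting it in
    -- front cuts the cyclic sequence open, and the resulting walk begins and ends at `l (fromℕ m)`.
    l₀ = l (fromℕ m) ∷ᶠ l

    on₀ : ∀ s → On (a s) (l₀ (inject₁ s))
    on₀ zero    = subst (λ s → On (a s) (l (fromℕ m))) (next-fromℕ m) (on-next (fromℕ m))
    on₀ (suc s) = subst (λ t → On (a t) (l (inject₁ s))) (next-inject₁ s) (on-next (inject₁ s))

-- Isomorphisms and induced subgraphs.

to-injective : ∀ {A B : Set} (f : A ↔ B) → Injective _≡_ _≡_ (to f)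
to-injective f {x} {y} eq =
  trans (sym (strictlyInverseʳ f x)) (trans (cong (from f) eq) (strictlyInverseʳ f y))

≅-sym : ∀ {G K} → G ≅ K → K ≅ G
≅-sym {G} {K} φ = record
  { vertices = ↔-sym vertices
  ; adjacent = λ u w →
      let u≡ = strictlyInverseˡ vertices u
          w≡ = strictlyInverseˡ vertices w
          e  = adjacent (from vertices u) (from vertices w)
      in mk⇔ (λ a → Equivalence.from e (subst₂ (Adj K) (sym u≡) (sym w≡) a))
             (λ a → subst₂ (Adj K) u≡ w≡ (Equivalence.to e a))
  } where open _≅_ φ

-- An isomorphism between `K` and `induced G P`, read as a map into `G` itself, so that links can be
-- assembled without handling irrelevant membership proofs.
record Embedding (K G : Graph) (P : Vertex G → Set) : Set where
  field
    embed     : Vertex K → Vertex G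
    injective : Injective _≡_ _≡_ embed
    inside    : ∀ x → P (embed x)
    onto      : ∀ u → P u → ∃[ x ] embed x ≡ u
    adjacent  : ∀ x y → Adj K x y ⇔ Adj G (embed x) (embed y)

module _ {K G : Graph} {P : Vertex G → Set} (P? : Decidable P) where

  inside-value : (u : Vertex (induced G P)) → P (value u)
  inside-value (u , [ p ]) = recompute (P? u) p

  embedding⇒≅ : Embedding K G P → induced G P ≅ K
  embedding⇒≅ ι = ≅-sym (record
    { vertices = ⤖⇒↔ (mk⤖ {to = λ x → embed x , [ inside x ]}
        ( (λ eq → injective (cong value eq))
        , λ u → let x , eq = onto (value u) (inside-value u)
                in x , λ { refl → value-injective eq }))
    ; adjacent = adjacent
    })
    where open Embedding ι

  ≅⇒embedding : induced G P ≅ K → Embedding K G P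
  ≅⇒embedding φ = record
    { embed     = value ∘ from vertices
    ; injective = λ eq → to-injective (↔-sym vertices) (value-injective eq)
    ; inside    = inside-value ∘ from vertices
    ; onto      = λ u p → to vertices (u , [ p ]) , cong value (strictlyInverseʳ vertices (u , [ p ]))
    ; adjacent  = _≅_.adjacent (≅-sym φ)
    } where open _≅_ φ

embedding-∘ : ∀ {L G K P Q} (φ : G ≅ K) → (∀ u → P u ⇔ Q (to (_≅_.vertices φ) u)) →
              Embedding L G P → Embedding L K Q
embedding-∘ {Q = Q} φ P⇔Q ι = record
  { embed     = to vertices ∘ embed
  ; injective = λ eq → injective (to-injective vertices eq)
  ; inside    = λ x → Equivalence.to (P⇔Q (embed x)) (inside x)
  ; onto      = λ u q →
      let u≡   = strictlyInverseˡ vertices u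
          x , eq = onto (from vertices u) (Equivalence.from (P⇔Q _) (subst Q (sym u≡) q))
      in x , trans (cong (to vertices) eq) u≡
  ; adjacent  = λ x y → mk⇔
      (λ a → Equivalence.to (_≅_.adjacent φ _ _) (Equivalence.to (Embedding.adjacent ι x y) a))
      (λ a → Equivalence.from (Embedding.adjacent ι x y) (Equivalence.from (_≅_.adjacent φ _ _) a))
  }
  where
  open _≅_ φ using (vertices)
  open Embedding ι using (embed; injective; inside; onto)

ConstantLink-resp-≅ : ∀ {G K L} → G ≅ K → ConstantLink G L → ConstantLink K L
ConstantLink-resp-≅ {G} {K} {L} φ G-link v =
  subst (λ w → induced K (Adj K w) ≅ L) (strictlyInverseˡ vertices v)
    (embedding⇒≅ (adj? K _) (embedding-∘ φ (adjacent (from vertices v))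
      (≅⇒embedding (adj? G _) (G-link (from vertices v)))))
  where open _≅_ φ

Cycle-resp-≅ : ∀ {G K ℓ} → G ≅ K → Cycle G ℓ → Cycle K ℓ
Cycle-resp-≅ φ c = record
  { 3≤ℓ      = 3≤ℓ
  ; vertex   = to vertices ∘ vertex
  ; distinct = λ eq → distinct (to-injective vertices eq)
  ; adjacent = λ i → Equivalence.to (_≅_.adjacent φ _ _) (Cycle.adjacent c i)
  }
  where
  open _≅_ φ using (vertices)
  open Cycle c using (3≤ℓ; vertex; distinct)

Connected-resp-≅ : ∀ {G K} → G ≅ K → Connected G → Connected K
Connected-resp-≅ {G} {K} φ (v , path) = to vertices v , λ u w →
  subst₂ (Star (Adj K)) (strictlyInverseˡ vertices u) (strictlyInverseˡ vertices w)
    (gmap (to vertices) (Equivalence.to (adjacent _ _)) (path (from vertices u) (from vertices w)))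
  where open _≅_ φ

ConstantLink-1· : ∀ {G L} → ConstantLink G L → ConstantLink G (1 · L)
ConstantLink-1· {G} G-link v = embedding⇒≅ (adj? G v) (record
  { embed     = embed ∘ proj₂
  ; injective = λ { {zero , _} {zero , _} eq → cong (zero ,_) (injective eq) }
  ; inside    = inside ∘ proj₂
  ; onto      = λ u p → let x , eq = onto u p in (zero , x) , eq
  ; adjacent  = λ { (zero , x) (zero , y) → mk⇔
      (λ (_ , a) → Equivalence.to (adjacent x y) a)
      (λ a → refl , Equivalence.from (adjacent x y) a) }
  })
  where open Embedding (≅⇒embedding (adj? G v) (G-link v))

-- Copies of `F` and `G` in `Γ C`, and its links.

module _ {N n : ℕ} {F G : Graph} {H : Hypergraph N} (C : Choices F G H n) where
  open Choices C

  private
    V : Set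
    V = Fin N × Fin n

    _∼_ : V → V → Set
    _∼_ = Adj (Γ C)

  block : V → Fin (size H)
  block (i , j) = E i j

  inCopy : V → Vertex G
  inCopy (i , j) = to (copy i) j

  point : ∀ e → Vertex F → V
  point e f = value (to (place e) f)

  point∈f : ∀ e f → point e f ∈f e
  point∈f e f with u , [ p ] ← to (place e) f = recompute (block u ≟ᶠ e) p

  coord : ∀ e u → u ∈f e → Vertex F
  coord e u p = from (place e) (u , [ p ])

  point-coord : ∀ {e} u (p : u ∈f e) → point e (coord e u p) ≡ u
  point-coord u p = cong value (strictlyInverseˡ (place _) (u , [ p ]))

  coord-point : ∀ e f (p : point e f ∈f e) → coord e (point e f) p ≡ f
  coord-point e f p = strictlyInverseʳ (place e) f

  point-injective : ∀ e → Injective _≡_ _≡_ (point e)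
  point-injective e eq = to-injective (place e) (value-injective eq)

  -- A copy of G meets a copy of F in at most one vertex.
  same-flag : ∀ {u w} → proj₁ u ≡ proj₁ w → block u ≡ block w → u ≡ w
  same-flag {i , _} {_ , _} refl eq = cong (i ,_) (E-distinct i eq)

  -- Ends that agree in both point and block would be one flag, and the edge a loop. `edge-irrefl`
  -- is the same argument with point and block exchanged. Together they keep the edges of the two
  -- kinds of copies apart.
  copy-irrefl : ∀ {u w} → AdjInCopy C u w → ¬ block u ≡ block w
  copy-irrefl {u} {w} (i≡j , a) eq with refl ← same-flag {u} {w} i≡j eq = adj-irrefl G a

  edge-irrefl : ∀ {u w e} → AdjOnEdge C e u w → ¬ proj₁ u ≡ proj₁ w
  edge-irrefl {u} {w} (p , q , a) i≡j with refl ← same-flag {u} {w} i≡j (trans p (sym q)) =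
    adj-irrefl F a

  -- Each copy of `G` is induced in `Γ C`, because an edge of a copy of `F` never joins two vertices
  -- over the same point.
  copy-adjacent : ∀ i {a b} → Adj G a b ⇔ ((i , from (copy i) a) ∼ (i , from (copy i) b))
  copy-adjacent i {a} {b} = mk⇔
    (λ ab → inj₁ (refl , subst₂ (Adj G) (sym a≡) (sym b≡) ab))
    λ where
      (inj₁ (_ , ab))   → subst₂ (Adj G) a≡ b≡ ab
      (inj₂ (e , e-ab)) → contradiction refl (edge-irrefl {i , _} {i , _} e-ab)
    where
    a≡ = strictlyInverseˡ (copy i) a
    b≡ = strictlyInverseˡ (copy i) b

  -- Each copy of `F` is induced too: edges in copies of `G` change the block, and a vertex
  -- determines its block, so no other copy of `F` contributes.
  edge-adjacent : ∀ e {f f′} → Adj F f f′ ⇔ (point e f ∼ point e f′)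
  edge-adjacent e {f} {f′} = mk⇔
    (λ ff′ → inj₂ (e , point∈f e f , point∈f e f′ , ff′-coord ff′))
    λ where
      (inj₁ ab)                → contradiction (trans (point∈f e f) (sym (point∈f e f′))) (copy-irrefl ab)
      (inj₂ (e′ , p , q , ff′)) → on-edge p q ff′
    where
    ff′-coord : Adj F f f′ → Adj F (coord e _ (point∈f e f)) (coord e _ (point∈f e f′))
    ff′-coord = subst₂ (Adj F)
      (sym (coord-point e f (point∈f e f))) (sym (coord-point e f′ (point∈f e f′)))

    on-edge : ∀ {e′} (p : point e f ∈f e′) (q : point e f′ ∈f e′) →
              Adj F (coord e′ _ p) (coord e′ _ q) → Adj F f f′
    on-edge p q ff′ with refl ← trans (sym p) (point∈f e f) =
      subst₂ (Adj F) (coord-point e f p) (coord-point e f′ q) ff′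

  -- The link of v consists of its link in the copy of F on the edge through v
  -- and its link in the copy of G containing v.
  module _ {L : Graph} {s : ℕ} (v : V)
           (λF : Embedding L F (Adj F (coord (block v) v refl)))
           (λG : Embedding (s · L) G (Adj G (inCopy v))) where

    private
      module F = Embedding λF
      module G = Embedding λG
      i = proj₁ v
      e = block v

    link-map : Fin (suc s) × Vertex L → V
    link-map (zero  , x) = point e (F.embed x)
    link-map (suc r , x) = i , from (copy i) (G.embed (r , x))

    edge-side : ∀ x → AdjOnEdge C e v (link-map (zero , x))
    edge-side x = refl , in-f , subst (Adj F _) (sym (coord-point e (F.embed x) in-f)) (F.inside x)
      where in-f = point∈f e (F.embed x)

    copy-side : ∀ r x → AdjInCopy C v (link-map (suc r , x))
    copy-side r x = refl , subst (Adj G _) (sym (strictlyInverseˡ (copy i) _)) (G.inside (r , x))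

    -- One neighbour shares the block of `v`, the other its point. An edge between them would make
    -- them share a point or a block, so that one of them would share both with `v`.
    sides-apart : ∀ x r y → ¬ link-map (zero , x) ∼ link-map (suc r , y)
    sides-apart x r y (inj₁ (i≡ , _))      = edge-irrefl {v} {link-map (zero , x)} (edge-side x) (sym i≡)
    sides-apart x r y (inj₂ (_ , p , q , _)) =
      copy-irrefl {v} {link-map (suc r , y)} (copy-side r y)
        (trans (sym (point∈f e _)) (trans p (sym q)))

    link-embedding : Embedding (suc s · L) (Γ C) (v ∼_)
    link-embedding = record
      { embed     = link-map
      ; injective = inj
      ; inside    = λ { (zero , x) → inj₂ (e , edge-side x) ; (suc r , x) → inj₁ (copy-side r x) }
      ; onto      = onto
      ; adjacent  = adjacent
      }
      where
      inj : Injective _≡_ _≡_ link-map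
      inj {zero , x}  {zero , y}  eq = cong (zero ,_) (F.injective (point-injective e eq))
      inj {zero , x}  {suc r , y} eq =
        contradiction (sym (cong proj₁ eq)) (edge-irrefl {v} {link-map (zero , x)} (edge-side x))
      inj {suc r , x} {zero , y}  eq =
        contradiction (cong proj₁ eq) (edge-irrefl {v} {link-map (zero , y)} (edge-side y))
      inj {suc r , x} {suc t , y} eq
        with refl ← G.injective (to-injective (↔-sym (copy i)) (cong proj₂ eq)) = refl

      onto : ∀ u → v ∼ u → ∃[ x ] link-map x ≡ u
      onto u (inj₁ (refl , a)) =
        let (r , x) , eq = G.onto (inCopy u) a
        in (suc r , x) , cong (i ,_) (trans (cong (from (copy i)) eq) (strictlyInverseʳ (copy i) _))
      onto u (inj₂ (_ , refl , q , a)) =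
        let x , eq = F.onto (coord e u q) a
        in (zero , x) , trans (cong (point e) eq) (point-coord u q)

      adjacent : ∀ x y → Adj (suc s · L) x y ⇔ (link-map x ∼ link-map y)
      adjacent (zero , x) (zero , y) = mk⇔
        (λ (_ , a) → Equivalence.to (edge-adjacent e) (Equivalence.to (F.adjacent x y) a))
        (λ a → refl , Equivalence.from (F.adjacent x y) (Equivalence.from (edge-adjacent e) a))
      adjacent (zero , x) (suc r , y) = mk⇔ (λ ()) (λ a → contradiction a (sides-apart x r y))
      adjacent (suc r , x) (zero , y) = mk⇔ (λ ())
        (λ a → contradiction (adj-sym (Γ C) {link-map (suc r , x)} {link-map (zero , y)} a)
                             (sides-apart y r x))
      adjacent (suc r , x) (suc t , y) = mk⇔
        (λ (r≡t , a) → Equivalence.to (copy-adjacent i)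
          (Equivalence.to (G.adjacent (r , x) (t , y)) (suc-injective r≡t , a)))
        (λ a → let r≡t , a′ = Equivalence.from (G.adjacent (r , x) (t , y))
                                (Equivalence.from (copy-adjacent i) a)
               in cong suc r≡t , a′)

  Γ-link : ∀ {L s} → ConstantLink F L → ConstantLink G (s · L) → ConstantLink (Γ C) (suc s · L)
  Γ-link F-link G-link v = embedding⇒≅ (adj? (Γ C) v)
    (link-embedding v (≅⇒embedding (adj? F _) (F-link _)) (≅⇒embedding (adj? G _) (G-link _)))

  -- Connectedness of `Γ C`.

  -- A walk in `H` is lifted step by step: inside the copy of `G` at the current point to the vertex
  -- on the next hyperedge, then across the copy of `F` on that hyperedge.
  Γ-connected : Connected F → Connected G → HConnected H → Connected (Γ C)
  Γ-connected (_ , F-path) (g , G-path) (i₀ , H-path) =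
    (i₀ , from (copy i₀) g) , λ (i , a) (j , b) → along (H-path i j) a b
    where
    within-copy : ∀ i a b → Star _∼_ (i , a) (i , b)
    within-copy i a b =
      subst₂ (λ a b → Star _∼_ (i , a) (i , b))
        (strictlyInverseʳ (copy i) a) (strictlyInverseʳ (copy i) b)
        (gmap (λ g → i , from (copy i) g) (Equivalence.to (copy-adjacent i))
          (G-path (to (copy i) a) (to (copy i) b)))

    within-edge : ∀ e {u w} → u ∈f e → w ∈f e → Star _∼_ u w
    within-edge e {u} {w} p q = subst₂ (Star _∼_) (point-coord u p) (point-coord w q)
      (gmap (point e) (Equivalence.to (edge-adjacent e)) (F-path (coord e u p) (coord e w q)))

    along : ∀ {i j} → Star (λ u w → ∃[ e ] (u ∈ edge H e × w ∈ edge H e)) i j →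
            ∀ a b → Star _∼_ (i , a) (j , b)
    along ε a b = within-copy _ a b
    along (_◅_ {i} {i′} (e , i∈e , i′∈e) path) a b =
      let c  , p  = Equivalence.to (E-through i e) i∈e
          c′ , p′ = Equivalence.to (E-through i′ e) i′∈e
      in within-copy i a c ◅◅ within-edge e p p′ ◅◅ along path c′ b

  -- Cycles of `Γ C`.

  label : ∀ {u w} → u ∼ w → Fin N ⊎ Fin (size H)
  label {u} (inj₁ _) = inj₁ (proj₁ u)
  label (inj₂ (e , _)) = inj₂ e

  flag : V → Fin N × Fin (size H)
  flag u = proj₁ u , block u

  label-on : ∀ {u w} (a : u ∼ w) → On (flag u) (label {u} {w} a)
  label-on (inj₁ _)               = onˡ
  label-on (inj₂ (_ , refl , _)) = onʳ

  label-onʳ : ∀ {u w} (a : u ∼ w) → On (flag w) (label {u} {w} a)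
  label-onʳ (inj₁ (refl , _))      = onˡ
  label-onʳ (inj₂ (_ , _ , refl , _)) = onʳ

  -- By `same-flag` the vertices of the cycle are distinct flags, so `closed-sequence` applies to
  -- the labels of its edges. A constant label is a point or a block, and places the cycle in one
  -- copy of `G` or of `F`.
  Γ-cycle : ∀ {ℓ} → Cycle (Γ C) ℓ →
            Cycle G ℓ ⊎ Cycle F ℓ ⊎ ∃[ m ] (2 * m ≤ ℓ × BergeCycle H m)
  Γ-cycle {suc ℓ} c
    with closed-sequence {R = λ i e → i ∈ edge H e} (≡-dec _≟ᶠ_ _≟ᶠ_)
           (λ s → flag (Cycle.vertex c s))
           (λ s → label {vertex s} {vertex (next s)} (adjacent s))
           (λ {s} {t} eq → distinct (same-flag (,-injectiveˡ eq) (,-injectiveʳ eq)))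
           (λ s → Equivalence.from (E-through _ _) (_ , refl))
           (λ s → label-on {vertex s} {vertex (next s)} (adjacent s))
           (λ s → label-onʳ {vertex s} {vertex (next s)} (adjacent s))
    where open Cycle c
  ... | inj₂ (m , 2m≤ℓ , d) = inj₂ (inj₂ (m , 2m≤ℓ , record
    { 2≤m             = D.2≤m
    ; vertex          = D.left
    ; edgeAt          = D.right
    ; vertex-distinct = D.left-injective
    ; edgeAt-distinct = D.right-injective
    ; incident        = λ s → x∈p∩q⁺ (D.incident-next s , D.incident (next s))
    }))
    where module D = IncidenceCycle d
  ... | inj₁ (inj₁ i , all-i) = inj₁ (record
    { 3≤ℓ      = 3≤ℓ
    ; vertex   = λ s → to (copy i) (proj₂ (vertex s))
    ; distinct = λ {s} {t} eq → distinct
        (trans (in-copy s) (trans (cong (i ,_) (to-injective (copy i) eq)) (sym (in-copy t))))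
    ; adjacent = λ s → proj₂ (step {vertex s} {vertex (next s)} (adjacent s) (all-i s))
    })
    where
    open Cycle c
    -- Only edges in a copy of `G` are labelled by a point, so the label equation leaves one case.
    step : ∀ {u w} (a : u ∼ w) → label {u} {w} a ≡ inj₁ i →
           u ≡ (i , proj₂ u) × Adj G (to (copy i) (proj₂ u)) (to (copy i) (proj₂ w))
    step (inj₁ (refl , a)) refl = refl , a

    in-copy : ∀ s → vertex s ≡ (i , proj₂ (vertex s))
    in-copy s = proj₁ (step {vertex s} {vertex (next s)} (adjacent s) (all-i s))
  ... | inj₁ (inj₂ e , all-e) = inj₂ (inj₁ (record
    { 3≤ℓ      = 3≤ℓ
    ; vertex   = λ s → coord e (vertex s) (on-edge s)
    ; distinct = λ {s} {t} eq → distinct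
        (trans (sym (point-coord _ (on-edge s))) (trans (cong (point e) eq) (point-coord _ (on-edge t))))
    ; adjacent = λ s → proj₂ (proj₂ (step {vertex s} {vertex (next s)} (adjacent s) (all-e s)))
    }))
    where
    open Cycle c
    step : ∀ {u w} (a : u ∼ w) → label {u} {w} a ≡ inj₂ e → AdjOnEdge C e u w
    step (inj₂ (_ , a)) refl = a

    on-edge : ∀ s → vertex s ∈f e
    on-edge s = proj₁ (step {vertex s} {vertex (next s)} (adjacent s) (all-e s))

-- Orders and the induction on `t`.

product-applyUpTo-suc : ∀ (f : ℕ → ℕ) m → product (applyUpTo f (suc m)) ≡ product (applyUpTo f m) * f m
product-applyUpTo-suc f m = begin
  product (applyUpTo f (suc m))           ≡⟨ cong product (applyUpTo-∷ʳ f m) ⟨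
  product (applyUpTo f m ++ f m ∷ [])     ≡⟨ product-++ (applyUpTo f m) (f m ∷ []) ⟩
  product (applyUpTo f m) * (f m * 1)     ≡⟨ cong (product (applyUpTo f m) *_) (*-identityʳ (f m)) ⟩
  product (applyUpTo f m) * f m           ∎
  where open ≡-Reasoning

theorem13 : (L F : Graph) (k : ℕ) → 3 ≤ k → ConstantLink F L → HasOrder F k →
    (n v : ℕ → ℕ) (H : (t : ℕ) → Hypergraph (v t)) →
    (∀ t → 1 ≤ t → Uniform (H t) k × Regular (H t) (n t)) →
    n 1 ≡ k →
    (∀ t → 2 ≤ t → n t ≡ k * product (applyUpTo (λ j → v (suc j)) (t ∸ 1))) →
    (G : ℕ → Graph) → G 1 ≡ F →
    (∀ i → 1 ≤ i → Admissible F L (G i) (H i) k (n i) →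
    IsΓ F (G i) (H i) (n i) (G (suc i))) →
    ∀ t → 1 ≤ t →
    (ConstantLink (G t) (t · L) × HasOrder (G t) (n t))
    × (∀ c g → Circumference F c → c < 2 * g →
    (∀ i → 1 ≤ i → i ≤ t ∸ 1 → Girth (H i) g) →
    ∀ ℓ → c < ℓ → ℓ < 2 * g → ¬ Cycle (G t) ℓ)
    × (Connected F → Connected (G t) → HConnected (H t) → Connected (G (suc t)))
theorem13 L F k 3≤k F-link F-order n v H H-params n₁≡k n≡ G G₁≡F G-suc (suc t) _ =
  link-order t , no-cycle t , connected
  where
  -- With the index shifted by one, the empty product also covers the first order, `n 1 ≡ k`.
  n-suc : ∀ t → n (suc t) ≡ k * product (applyUpTo (λ j → v (suc j)) t)
  n-suc zero    = trans n₁≡k (sym (*-identityʳ k))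
  n-suc (suc t) = n≡ (suc (suc t)) (s≤s (s≤s z≤n))

  -- This matches the order of `Γ C`, which consists of one copy of the previous graph for each
  -- point of the hypergraph.
  n-step : ∀ t → n (suc (suc t)) ≡ v (suc t) * n (suc t)
  n-step t = begin
    n (suc (suc t))                          ≡⟨ n-suc (suc t) ⟩
    k * product (applyUpTo v⁺ (suc t))        ≡⟨ cong (k *_) (product-applyUpTo-suc v⁺ t) ⟩
    k * (product (applyUpTo v⁺ t) * v⁺ t)     ≡⟨ *-assoc k _ _ ⟨
    k * product (applyUpTo v⁺ t) * v⁺ t       ≡⟨ cong (_* v⁺ t) (n-suc t) ⟨
    n (suc t) * v⁺ t                         ≡⟨ *-comm (n (suc t)) (v⁺ t) ⟩
    v⁺ t * n (suc t)                         ∎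
    where
    open ≡-Reasoning
    v⁺ : ℕ → ℕ
    v⁺ j = v (suc j)

  -- Link and order go through one induction, since admissibility, the premise for the next graph to
  -- be a `Γ`, asks for both.
  LinkOrder : ℕ → Set
  LinkOrder t = ConstantLink (G (suc t)) (suc t · L) × HasOrder (G (suc t)) (n (suc t))

  isΓ : ∀ t → LinkOrder t → IsΓ F (G (suc t)) (H (suc t)) (n (suc t)) (G (suc (suc t)))
  isΓ t (link , order) = G-suc (suc t) (s≤s z≤n) (record
    { 3≤k       = 3≤k
    ; F-link    = F-link
    ; F-order   = F-order
    ; G-link    = suc t , s≤s z≤n , link
    ; G-order   = order
    ; H-uniform = proj₁ (H-params (suc t) (s≤s z≤n))
    ; H-regular = proj₂ (H-params (suc t) (s≤s z≤n))
    })

  link-order : ∀ t → LinkOrder t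
  link-order zero =
    subst (λ K → ConstantLink K (1 · L)) (sym G₁≡F) (ConstantLink-1· F-link) ,
    subst₂ HasOrder (sym G₁≡F) (sym n₁≡k) F-order
  link-order (suc t) with C , φ ← isΓ t (link-order t) =
    ConstantLink-resp-≅ (≅-sym φ) (Γ-link C F-link (proj₁ (link-order t))) ,
    subst (HasOrder (G (suc (suc t)))) (sym (n-step t)) (↔-trans *↔× (↔-sym (_≅_.vertices φ)))

  -- Induction on `t`: a cycle of the new graph lies in the previous graph, lies in `F` and has
  -- length at most `c`, or yields a short Berge cycle.
  no-cycle : ∀ t c g → Circumference F c → c < 2 * g →
    (∀ i → 1 ≤ i → i ≤ t → Girth (H i) g) →
    ∀ ℓ → c < ℓ → ℓ < 2 * g → ¬ Cycle (G (suc t)) ℓ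
  no-cycle zero c g (_ , longest) _ _ ℓ c<ℓ _ d =
    <⇒≱ c<ℓ (longest ℓ (subst (λ K → Cycle K ℓ) G₁≡F d))
  no-cycle (suc t) c g F-circ@(_ , longest) c<2g girth ℓ c<ℓ ℓ<2g d
    with C , φ ← isΓ t (link-order t)
    with Γ-cycle C (Cycle-resp-≅ φ d)
  ... | inj₁ d′ =
    no-cycle t c g F-circ c<2g (λ i 1≤i i≤t → girth i 1≤i (m≤n⇒m≤1+n i≤t)) ℓ c<ℓ ℓ<2g d′
  ... | inj₂ (inj₁ d′) = <⇒≱ c<ℓ (longest ℓ d′)
  -- The girth gives `g ≤ m`, hence `2 * g ≤ 2 * m ≤ ℓ < 2 * g`.
  ... | inj₂ (inj₂ (m , 2m≤ℓ , b)) =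
    <⇒≱ (≤-<-trans 2m≤ℓ ℓ<2g) (*-monoʳ-≤ 2 (proj₂ (girth (suc t) (s≤s z≤n) ≤-refl) m b))

  connected : Connected F → Connected (G (suc t)) → HConnected (H (suc t)) → Connected (G (suc (suc t)))
  connected F-conn G-conn H-conn with C , φ ← isΓ t (link-order t) =
    Connected-resp-≅ (≅-sym φ) (Γ-connected C F-conn G-conn H-conn)
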